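{- Every double cover of $\{0,1,2\}^6$ has at least $60$ boxes; that is, $f(6)\ge 60$.
   Context: Write $[3]=\{0,1,2\}$. A proper sub-box of $[3]^d$ is a set $B=S_1\times\dots\times S_d$ with $\varnothing\neq S_i\subsetneq[3]$ for every $1\le i\le d$ (so each side $S_i$ has one or two elements). A double cover of $[3]^d$ is a finite multiset $\{B_1,\dots,B_m\}$ of proper sub-boxes such that every point of $[3]^d$ lies in exactly two of the $B_j$, counted with multiplicity; its size is $m$. $f(d)$ denotes the minimum size of a double cover of $[3]^d$. -}

module Defs where

open import Data.Fin.Base using (Fin)
open import Data.Fin.Subset using (Subset; Nonempty; _⊂_; ⊤) renaming (_∈_ to _∈ₛ_)
open import Data.Fin.Subset.Properties using () renaming (_∈?_ to _∈ₛ?_)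
open import Data.List.Base using (List; filter; length)
open import Data.List.Relation.Unary.All using (All)
open import Data.Nat.Base using (ℕ)
open import Data.Product.Base using (_×_)
open import Data.Vec.Base using (Vec)
open import Data.Vec.Relation.Binary.Pointwise.Inductive using (Pointwise; decidable)
import Data.Vec.Relation.Unary.All as Vec
open import Relation.Binary.PropositionalEquality.Core using (_≡_)
open import Relation.Nullary.Decidable.Core using (Dec)

Point : ℕ → Set
Point d = Vec (Fin 3) d

-- A box S₁ × … × S_d is given by its vector of sides. When all sides are
-- nonempty, as in a proper box, the sides are determined by the product set.
Box : ℕ → Set
Box d = Vec (Subset 3) d

IsProper : ∀ {d} → Box d → Set
IsProper = Vec.All (λ S → Nonempty S × S ⊂ ⊤)

infix 4 _∈_ _∈?_

_∈_ : ∀ {d} → Point d → Box d → Set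
_∈_ = Pointwise _∈ₛ_

_∈?_ : ∀ {d} (x : Point d) (B : Box d) → Dec (x ∈ B)
_∈?_ = decidable _∈ₛ?_

multiplicity : ∀ {d} → Point d → List (Box d) → ℕ
multiplicity x Bs = length (filter (x ∈?_) Bs)

-- A finite multiset of boxes is represented by a list enumerating it with
-- repetitions; neither the condition below nor the size (the length of the
-- list) depends on the order of enumeration.
record IsDoubleCover {d : ℕ} (Bs : List (Box d)) : Set where
  field
    proper : All IsProper Bs
    twice  : ∀ (x : Point d) → multiplicity x Bs ≡ 2

{-# OPTIONS --safe #-}

-- Write a double cover as Σ_B 1_B = 2 and evaluate product functionals
-- c = c₁ ⊗ … ⊗ c_d on it, where each c_i is either evaluation at a point of
-- [3] or a sum of signs with exactly one minus sign. Since c takes an odd value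
-- on the whole cube, Σ_B c(B) ≡ 2 modulo 4, so the distances from the numbers
-- c(B) to 4ℤ add up to at least 2. The distance is positive only if c(B) is odd
-- or twice an odd number. Averaging over all c, weighted by the number of sign
-- sums among the c_i, bounds what a single box can contribute in terms of the
-- number of its two-element sides, and a suitable choice of weights gives 60.
module Submission where

open import Defs
open import Algebra.Properties.CommutativeSemigroup using (interchange)
open import Data.Bool.Base using (Bool; true; false; _∧_; if_then_else_)
open import Data.Fin.Base using (Fin)
open import Data.Fin.Patterns using (0F; 1F; 2F)
open import Data.Fin.Properties using (_≟_)
open import Data.Fin.Subset using (Subset; Nonempty; _⊂_; ⊤; ∣_∣)
open import Data.Fin.Subset.Properties using (anySubset?; ∈⊤; ∉⊥) renaming (_∈?_ to _∈ₛ?_)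
open import Data.List.Base using (List; []; _∷_; _++_; allFin; cartesianProductWith; length; map)
open import Data.List.Properties using (map-∘; map-++; map-cong)
open import Data.List.Relation.Unary.All as All using (All; []; _∷_)
open import Data.Nat.Base using (ℕ; zero; suc; _+_; _*_; _≤_; _≡ᵇ_; z≤n; s≤s)
open import Data.Nat.ListAction using (sum)
open import Data.Nat.ListAction.Properties using (sum-++)
open import Data.Nat.Properties hiding (_≟_)
open import Data.Product.Base using (_×_; _,_)
open import Data.Vec.Base as Vec using (Vec; []; _∷_)
open import Data.Vec.Relation.Unary.All using ([]; _∷_)
open import Function.Base using (_∘_)
open import Relation.Binary.PropositionalEquality
open import Relation.Nullary using (does; contradiction)
open import Relation.Nullary.Decidable using (from-no; from-yes)

private
  variable
    A C : Set
    d : ℕ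

-- Finite sums over lists

infixr 5 ∑

∑ : List A → (A → ℕ) → ℕ
∑ xs f = sum (map f xs)

syntax ∑ xs (λ x → e) = ∑[ x ∈ xs ] e

∑-cong : (xs : List A) {f g : A → ℕ} → (∀ x → f x ≡ g x) → ∑ xs f ≡ ∑ xs g
∑-cong xs f≗g = cong sum (map-cong f≗g xs)

∑-mono-≤ : (xs : List A) {f g : A → ℕ} → (∀ x → f x ≤ g x) → ∑ xs f ≤ ∑ xs g
∑-mono-≤ []       f≤g = z≤n
∑-mono-≤ (x ∷ xs) f≤g = +-mono-≤ (f≤g x) (∑-mono-≤ xs f≤g)

∑-zero : (xs : List A) → ∑[ x ∈ xs ] 0 ≡ 0
∑-zero []       = refl
∑-zero (x ∷ xs) = ∑-zero xs

∑-+ : (xs : List A) (f g : A → ℕ) → ∑[ x ∈ xs ] (f x + g x) ≡ ∑ xs f + ∑ xs g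
∑-+ []       f g = refl
∑-+ (x ∷ xs) f g = trans (cong (f x + g x +_) (∑-+ xs f g))
  (interchange +-commutativeSemigroup (f x) (g x) (∑ xs f) (∑ xs g))

∑-*ˡ : (xs : List A) (m : ℕ) (f : A → ℕ) → ∑[ x ∈ xs ] m * f x ≡ m * ∑ xs f
∑-*ˡ []       m f = sym (*-zeroʳ m)
∑-*ˡ (x ∷ xs) m f = trans (cong (m * f x +_) (∑-*ˡ xs m f))
  (sym (*-distribˡ-+ m (f x) (∑ xs f)))

∑-*ʳ : (xs : List A) (f : A → ℕ) (m : ℕ) → ∑[ x ∈ xs ] f x * m ≡ ∑ xs f * m
∑-*ʳ []       f m = refl
∑-*ʳ (x ∷ xs) f m = trans (cong (f x * m +_) (∑-*ʳ xs f m))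
  (sym (*-distribʳ-+ m (f x) (∑ xs f)))

∑-swap : (xs : List A) (ys : List C) (f : A → C → ℕ) →
         ∑[ x ∈ xs ] (∑[ y ∈ ys ] f x y) ≡ ∑[ y ∈ ys ] (∑[ x ∈ xs ] f x y)
∑-swap []       ys f = sym (∑-zero ys)
∑-swap (x ∷ xs) ys f = trans (cong (∑ ys (f x) +_) (∑-swap xs ys f))
  (sym (∑-+ ys (f x) (λ y → ∑[ x ∈ xs ] f x y)))

∑-bounded : {xs : List A} {f : A → ℕ} {m : ℕ} → All (λ x → f x ≤ m) xs → ∑ xs f ≤ length xs * m
∑-bounded []       = z≤n
∑-bounded (p ∷ ps) = +-mono-≤ p (∑-bounded ps)

vectors : List A → ∀ d → List (Vec A d)
vectors xs zero    = [] ∷ []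
vectors xs (suc d) = cartesianProductWith _∷_ xs (vectors xs d)

∑-cartesianProductWith : {D : Set} (h : A → C → D) (xs : List A) (ys : List C) (f : D → ℕ) →
  ∑ (cartesianProductWith h xs ys) f ≡ ∑[ x ∈ xs ] (∑[ y ∈ ys ] f (h x y))
∑-cartesianProductWith h []       ys f = refl
∑-cartesianProductWith h (x ∷ xs) ys f = begin
  sum (map f (map (h x) ys ++ zs))       ≡⟨ cong sum (map-++ f (map (h x) ys) zs) ⟩
  sum (map f (map (h x) ys) ++ map f zs) ≡⟨ sum-++ (map f (map (h x) ys)) (map f zs) ⟩
  ∑ (map (h x) ys) f + ∑ zs f            ≡⟨ cong₂ _+_ (cong sum (sym (map-∘ ys)))
                                                     (∑-cartesianProductWith h xs ys f) ⟩
  ∑ ys (f ∘ h x) + (∑[ z ∈ xs ] ∑[ y ∈ ys ] f (h z y)) ∎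
  where
  open ≡-Reasoning
  zs = cartesianProductWith h xs ys

-- Distributivity over a product set: product functionals can be summed one coordinate at a time.
∑-factor : (xs : List A) {F : Vec A (suc d) → ℕ} (f : A → ℕ) (g : Vec A d → ℕ) →
           (∀ x v → F (x ∷ v) ≡ f x * g v) →
           ∑ (vectors xs (suc d)) F ≡ ∑ xs f * ∑ (vectors xs d) g
∑-factor {d = d} xs {F} f g F≗fg = begin
  ∑ (vectors xs (suc d)) F                          ≡⟨ ∑-cartesianProductWith _∷_ xs (vectors xs d) F ⟩
  ∑[ x ∈ xs ] (∑[ v ∈ vectors xs d ] F (x ∷ v))     ≡⟨ ∑-cong xs (λ x → ∑-cong (vectors xs d) (F≗fg x)) ⟩
  ∑[ x ∈ xs ] (∑[ v ∈ vectors xs d ] f x * g v)     ≡⟨ ∑-cong xs (λ x → ∑-*ˡ (vectors xs d) (f x) g) ⟩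
  ∑[ x ∈ xs ] f x * ∑ (vectors xs d) g              ≡⟨ ∑-*ʳ xs f (∑ (vectors xs d) g) ⟩
  ∑ xs f * ∑ (vectors xs d) g                       ∎
  where open ≡-Reasoning

-- Distance to the multiples of 4

∥_∥₄ : ℕ → ℕ
∥ 0 ∥₄ = 0
∥ 1 ∥₄ = 1
∥ 2 ∥₄ = 2
∥ 3 ∥₄ = 1
∥ suc (suc (suc (suc n))) ∥₄ = ∥ n ∥₄

∥∥≤2 : ∀ n → ∥ n ∥₄ ≤ 2
∥∥≤2 0 = z≤n
∥∥≤2 1 = s≤s z≤n
∥∥≤2 2 = ≤-refl
∥∥≤2 3 = s≤s z≤n
∥∥≤2 (suc (suc (suc (suc n)))) = ∥∥≤2 n

∥1+∥ : ∀ n → ∥ 1 + n ∥₄ ≤ 1 + ∥ n ∥₄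
∥1+∥ 0 = ≤-refl
∥1+∥ 1 = ≤-refl
∥1+∥ 2 = s≤s z≤n
∥1+∥ 3 = z≤n
∥1+∥ (suc (suc (suc (suc n)))) = ∥1+∥ n

∥3+∥ : ∀ n → ∥ 3 + n ∥₄ ≤ 1 + ∥ n ∥₄
∥3+∥ 0 = ≤-refl
∥3+∥ 1 = z≤n
∥3+∥ 2 = s≤s z≤n
∥3+∥ 3 = ≤-refl
∥3+∥ (suc (suc (suc (suc n)))) = ∥3+∥ n

-- Adding 1, or 3 (which is -1 modulo 4), raises the distance by at most 1. Adding 2 is two steps of
-- 1, and a larger `m` reduces by periodicity.
∥∥-subadditive : ∀ m n → ∥ m + n ∥₄ ≤ ∥ m ∥₄ + ∥ n ∥₄
∥∥-subadditive 0 n = ≤-refl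
∥∥-subadditive 1 n = ∥1+∥ n
∥∥-subadditive 2 n = ≤-trans (∥1+∥ (1 + n)) (s≤s (∥1+∥ n))
∥∥-subadditive 3 n = ∥3+∥ n
∥∥-subadditive (suc (suc (suc (suc m)))) n = ∥∥-subadditive m n

∥∥-∑ : (xs : List A) (f : A → ℕ) → ∥ ∑ xs f ∥₄ ≤ ∑[ x ∈ xs ] ∥ f x ∥₄
∥∥-∑ []       f = z≤n
∥∥-∑ (x ∷ xs) f = ≤-trans (∥∥-subadditive (f x) (∑ xs f)) (+-monoʳ-≤ ∥ f x ∥₄ (∥∥-∑ xs f))

∥4*+∥ : ∀ m n → ∥ 4 * m + n ∥₄ ≡ ∥ n ∥₄
∥4*+∥ zero    n = refl
∥4*+∥ (suc m) n = trans (cong (λ k → ∥ k + n ∥₄) (*-suc 4 m)) (∥4*+∥ m n)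

∥3*∥ : ∀ n → ∥ 3 * n ∥₄ ≡ ∥ n ∥₄
∥3*∥ 0 = refl
∥3*∥ 1 = refl
∥3*∥ 2 = refl
∥3*∥ 3 = refl
∥3*∥ (suc (suc (suc (suc n)))) = trans (cong ∥_∥₄ (*-distribˡ-+ 3 4 n)) (∥3*∥ n)

-- Modulo 4, `m` is `∥ m ∥₄` or its negative, and the distance ignores signs. Hence a partial
-- product need only be remembered up to sign modulo 4, as one of 0, 1, 2.
∥∥-*ˡ : ∀ m n → ∥ m * n ∥₄ ≡ ∥ ∥ m ∥₄ * n ∥₄
∥∥-*ˡ 0 n = refl
∥∥-*ˡ 1 n = refl
∥∥-*ˡ 2 n = refl
∥∥-*ˡ 3 n = trans (∥3*∥ n) (cong ∥_∥₄ (sym (*-identityˡ n)))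
∥∥-*ˡ (suc (suc (suc (suc m)))) n = begin
  ∥ (4 + m) * n ∥₄   ≡⟨ cong ∥_∥₄ (*-distribʳ-+ n 4 m) ⟩
  ∥ 4 * n + m * n ∥₄ ≡⟨ ∥4*+∥ n (m * n) ⟩
  ∥ m * n ∥₄         ≡⟨ ∥∥-*ˡ m n ⟩
  ∥ ∥ m ∥₄ * n ∥₄    ∎
  where open ≡-Reasoning

-- Product functionals on boxes and covers

data Form : Set where
  point signed : Fin 3 → Form

-- Only residues modulo 4 matter, so the coefficient −1 is written 3.
coeff : Form → Fin 3 → ℕ
coeff (point a)  x = if does (x ≟ a) then 1 else 0
coeff (signed a) x = if does (x ≟ a) then 3 else 1

forms : List Form
forms = map point (allFin 3) ++ map signed (allFin 3)

⟦_⟧ : Bool → ℕ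
⟦ b ⟧ = if b then 1 else 0

⟦∧⟧ : ∀ a b → ⟦ a ∧ b ⟧ ≡ ⟦ a ⟧ * ⟦ b ⟧
⟦∧⟧ true  b = sym (*-identityˡ ⟦ b ⟧)
⟦∧⟧ false b = refl

sideValue : Form → Subset 3 → ℕ
sideValue c S = ∑[ x ∈ allFin 3 ] ⟦ does (x ∈ₛ? S) ⟧ * coeff c x

value : Vec Form d → Box d → ℕ
value []       []      = 1
value (c ∷ cs) (S ∷ B) = sideValue c S * value cs B

coeffs : Vec Form d → Point d → ℕ
coeffs []       []      = 1
coeffs (c ∷ cs) (x ∷ p) = coeff c x * coeffs cs p

points : ∀ d → List (Point d)
points = vectors (allFin 3)

-- Expanding the product of side sums gives one term per point of the box, the form in which summing
-- over a cover produces multiplicities.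
value-∑ : (cs : Vec Form d) (B : Box d) →
          value cs B ≡ ∑[ p ∈ points d ] ⟦ does (p ∈? B) ⟧ * coeffs cs p
value-∑ []       []      = refl
value-∑ (c ∷ cs) (S ∷ B) = trans (cong (sideValue c S *_) (value-∑ cs B))
  (sym (∑-factor (allFin 3) (λ x → ⟦ does (x ∈ₛ? S) ⟧ * coeff c x) (λ p → ⟦ does (p ∈? B) ⟧ * coeffs cs p) λ x p →
    trans (cong (_* (coeff c x * coeffs cs p)) (⟦∧⟧ (does (x ∈ₛ? S)) (does (p ∈? B))))
      (interchange *-commutativeSemigroup ⟦ does (x ∈ₛ? S) ⟧ _ (coeff c x) _)))

∑-coeff : ∀ c → ∥ 2 * ∑ (allFin 3) (coeff c) ∥₄ ≡ 2
∑-coeff (point 0F)  = refl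
∑-coeff (point 1F)  = refl
∑-coeff (point 2F)  = refl
∑-coeff (signed 0F) = refl
∑-coeff (signed 1F) = refl
∑-coeff (signed 2F) = refl

-- Each one-coordinate total is 1 or 5, and multiplying by an odd number preserves 2 modulo 4. The
-- totals are absorbed into the 2 one at a time.
∑-coeffs : (cs : Vec Form d) → ∥ 2 * ∑ (points d) (coeffs cs) ∥₄ ≡ 2
∑-coeffs []               = refl
∑-coeffs {suc d} (c ∷ cs) = begin
  ∥ 2 * ∑ (points (suc d)) (coeffs (c ∷ cs)) ∥₄ ≡⟨ cong (λ n → ∥ 2 * n ∥₄) (∑-factor (allFin 3) (coeff c) (coeffs cs) (λ _ _ → refl)) ⟩
  ∥ 2 * (t * r) ∥₄                              ≡⟨ cong ∥_∥₄ (*-assoc 2 t r) ⟨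
  ∥ 2 * t * r ∥₄                                ≡⟨ ∥∥-*ˡ (2 * t) r ⟩
  ∥ ∥ 2 * t ∥₄ * r ∥₄                           ≡⟨ cong (λ n → ∥ n * r ∥₄) (∑-coeff c) ⟩
  ∥ 2 * r ∥₄                                    ≡⟨ ∑-coeffs cs ⟩
  2                                             ∎
  where
  open ≡-Reasoning
  t = ∑ (allFin 3) (coeff c)
  r = ∑ (points d) (coeffs cs)

multiplicity-∑ : (p : Point d) (Bs : List (Box d)) → multiplicity p Bs ≡ ∑[ B ∈ Bs ] ⟦ does (p ∈? B) ⟧
multiplicity-∑ p []       = refl
multiplicity-∑ p (B ∷ Bs) with does (p ∈? B)
... | true  = cong suc (multiplicity-∑ p Bs)
... | false = multiplicity-∑ p Bs

∑-value : (Bs : List (Box d)) → IsDoubleCover Bs → (cs : Vec Form d) →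
          ∑[ B ∈ Bs ] value cs B ≡ 2 * ∑ (points d) (coeffs cs)
∑-value {d} Bs cover cs = begin
  ∑[ B ∈ Bs ] value cs B
    ≡⟨ ∑-cong Bs (value-∑ cs) ⟩
  ∑[ B ∈ Bs ] (∑[ p ∈ points d ] ⟦ does (p ∈? B) ⟧ * coeffs cs p)
    ≡⟨ ∑-swap Bs (points d) _ ⟩
  ∑[ p ∈ points d ] (∑[ B ∈ Bs ] ⟦ does (p ∈? B) ⟧ * coeffs cs p)
    ≡⟨ ∑-cong (points d) (λ p → ∑-*ʳ Bs _ (coeffs cs p)) ⟩
  ∑[ p ∈ points d ] (∑[ B ∈ Bs ] ⟦ does (p ∈? B) ⟧) * coeffs cs p
    ≡⟨ ∑-cong (points d) (λ p → cong (_* coeffs cs p) (trans (sym (multiplicity-∑ p Bs)) (twice p))) ⟩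
  ∑[ p ∈ points d ] 2 * coeffs cs p
    ≡⟨ ∑-*ˡ (points d) 2 (coeffs cs) ⟩
  2 * ∑ (points d) (coeffs cs) ∎
  where
  open ≡-Reasoning
  open IsDoubleCover cover

2≤∑∥value∥ : (Bs : List (Box d)) → IsDoubleCover Bs → (cs : Vec Form d) →
            2 ≤ ∑[ B ∈ Bs ] ∥ value cs B ∥₄
2≤∑∥value∥ Bs cover cs = begin
  2                                 ≡⟨ ∑-coeffs cs ⟨
  ∥ 2 * ∑ (points _) (coeffs cs) ∥₄ ≡⟨ cong ∥_∥₄ (∑-value Bs cover cs) ⟨
  ∥ ∑[ B ∈ Bs ] value cs B ∥₄       ≤⟨ ∥∥-∑ Bs (value cs) ⟩
  ∑[ B ∈ Bs ] ∥ value cs B ∥₄       ∎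
  where open ≤-Reasoning

-- Weighted cost of a single box

signs : Form → ℕ
signs (point _)  = 0
signs (signed _) = 1

signCount : Vec Form d → ℕ
signCount []       = 0
signCount (c ∷ cs) = signs c + signCount cs

-- The parameters `u` and `s` make recursion on the sides possible: `s` absorbs the value of a
-- removed side, and `u` is shifted when its form is a sign sum.
cost : (ℕ → ℕ) → ℕ → Box d → ℕ
cost {d} u s B = ∑[ cs ∈ vectors forms d ] u (signCount cs) * ∥ s * value cs B ∥₄

cost-∷ : ∀ (u : ℕ → ℕ) s S (B : Box d) →
         cost u s (S ∷ B) ≡ ∑[ c ∈ forms ] cost (λ j → u (signs c + j)) (s * sideValue c S) B
cost-∷ {d} u s S B = trans (∑-cartesianProductWith _∷_ forms (vectors forms d) _)
  (∑-cong forms λ c → ∑-cong (vectors forms d) λ cs →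
    cong (λ n → u (signs c + signCount cs) * ∥ n ∥₄) (sym (*-assoc s (sideValue c S) (value cs B))))

-- The cost of a box depends only on the set of its two-element sides: modulo 4
-- and up to order, a one-element side has values 1, 0, 0 under the point
-- evaluations and ±1, ±1, ±1 under the sign sums, a two-element side has values
-- 1, 1, 0 and 2, 0, 0 respectively.
pairCost : (ℕ → ℕ) → ℕ → Subset d → ℕ
pairCost u 0 K           = 0
pairCost u s []          = u 0 * ∥ s ∥₄
pairCost u s (false ∷ K) = sum (pairCost u s K ∷ y ∷ y ∷ y ∷ [])
  where y = pairCost (u ∘ suc) s K
pairCost u s (true ∷ K)  = sum (x ∷ x ∷ pairCost (u ∘ suc) ∥ s * 2 ∥₄ K ∷ [])
  where x = pairCost u s K

isPair : Subset 3 → Bool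
isPair S = ∣ S ∣ ≡ᵇ 2

-- Matching on `s ≤ 2` enumerates `s` as 0, 1, 2. In each case the vanishing forms contribute
-- literal zeros that compute away, leaving the same summands in the same order.
pairCost-∷ : ∀ (u : ℕ → ℕ) {s} S (K : Subset d) → s ≤ 2 → Nonempty S × S ⊂ ⊤ →
  ∑[ c ∈ forms ] pairCost (λ j → u (signs c + j)) ∥ s * sideValue c S ∥₄ K ≡ pairCost u s (isPair S ∷ K)
pairCost-∷ u S                            K z≤n             _ = refl
pairCost-∷ u (true  ∷ false ∷ false ∷ []) K (s≤s z≤n)       _ = refl
pairCost-∷ u (false ∷ true  ∷ false ∷ []) K (s≤s z≤n)       _ = refl
pairCost-∷ u (false ∷ false ∷ true  ∷ []) K (s≤s z≤n)       _ = refl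
pairCost-∷ u (true  ∷ true  ∷ false ∷ []) K (s≤s z≤n)       _ = refl
pairCost-∷ u (true  ∷ false ∷ true  ∷ []) K (s≤s z≤n)       _ = refl
pairCost-∷ u (false ∷ true  ∷ true  ∷ []) K (s≤s z≤n)       _ = refl
pairCost-∷ u (true  ∷ false ∷ false ∷ []) K (s≤s (s≤s z≤n)) _ = refl
pairCost-∷ u (false ∷ true  ∷ false ∷ []) K (s≤s (s≤s z≤n)) _ = refl
pairCost-∷ u (false ∷ false ∷ true  ∷ []) K (s≤s (s≤s z≤n)) _ = refl
pairCost-∷ u (true  ∷ true  ∷ false ∷ []) K (s≤s (s≤s z≤n)) _ = refl
pairCost-∷ u (true  ∷ false ∷ true  ∷ []) K (s≤s (s≤s z≤n)) _ = refl
pairCost-∷ u (false ∷ true  ∷ true  ∷ []) K (s≤s (s≤s z≤n)) _ = refl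
pairCost-∷ u (false ∷ false ∷ false ∷ []) K _ ((_ , x∈⊥) , _) = contradiction x∈⊥ ∉⊥
pairCost-∷ u (true  ∷ true  ∷ true  ∷ []) K _ (_ , _ , _ , _ , x∉⊤) = contradiction ∈⊤ x∉⊤

pairCost-[] : ∀ u s → u 0 * ∥ s ∥₄ ≡ pairCost u ∥ s ∥₄ []
pairCost-[] u 0 = *-zeroʳ (u 0)
pairCost-[] u 1 = refl
pairCost-[] u 2 = refl
pairCost-[] u 3 = refl
pairCost-[] u (suc (suc (suc (suc s)))) = pairCost-[] u s

cost≡pairCost : ∀ u s {B : Box d} → IsProper B → cost u s B ≡ pairCost u ∥ s ∥₄ (Vec.map isPair B)
cost≡pairCost u s {[]} [] = begin
  u 0 * ∥ s * 1 ∥₄ + 0   ≡⟨ +-identityʳ _ ⟩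
  u 0 * ∥ s * 1 ∥₄       ≡⟨ cong (λ n → u 0 * ∥ n ∥₄) (*-identityʳ s) ⟩
  u 0 * ∥ s ∥₄           ≡⟨ pairCost-[] u s ⟩
  pairCost u ∥ s ∥₄ []   ∎
  where open ≡-Reasoning
cost≡pairCost u s {S ∷ B} (pS ∷ pB) = begin
  cost u s (S ∷ B)
    ≡⟨ cost-∷ u s S B ⟩
  ∑[ c ∈ forms ] cost (λ j → u (signs c + j)) (s * sideValue c S) B
    ≡⟨ ∑-cong forms (λ c → cost≡pairCost (λ j → u (signs c + j)) (s * sideValue c S) pB) ⟩
  ∑[ c ∈ forms ] pairCost (λ j → u (signs c + j)) ∥ s * sideValue c S ∥₄ K
    -- Reducing `s` modulo 4 up to sign leaves only the three values that `pairCost-∷` handles.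
    ≡⟨ ∑-cong forms (λ c → cong (λ n → pairCost (λ j → u (signs c + j)) n K) (∥∥-*ˡ s (sideValue c S))) ⟩
  ∑[ c ∈ forms ] pairCost (λ j → u (signs c + j)) ∥ ∥ s ∥₄ * sideValue c S ∥₄ K
    ≡⟨ pairCost-∷ u S K (∥∥≤2 s) pS ⟩
  pairCost u ∥ s ∥₄ (isPair S ∷ K) ∎
  where
  open ≡-Reasoning
  K = Vec.map isPair B

-- Averaging over functionals and the numerical bound

∑-weights≤∑-cost : (u : ℕ → ℕ) (Bs : List (Box d)) → IsDoubleCover Bs →
  ∑[ cs ∈ vectors forms d ] u (signCount cs) * 2 ≤ ∑[ B ∈ Bs ] cost u 1 B
∑-weights≤∑-cost {d} u Bs cover = begin
  ∑[ cs ∈ vectors forms d ] u (signCount cs) * 2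
    ≤⟨ ∑-mono-≤ (vectors forms d) (λ cs → *-monoʳ-≤ (u (signCount cs)) (2≤∑∥value∥ Bs cover cs)) ⟩
  ∑[ cs ∈ vectors forms d ] u (signCount cs) * (∑[ B ∈ Bs ] ∥ value cs B ∥₄)
    ≡⟨ ∑-cong (vectors forms d) (λ cs → ∑-*ˡ Bs (u (signCount cs)) _) ⟨
  ∑[ cs ∈ vectors forms d ] ∑[ B ∈ Bs ] u (signCount cs) * ∥ value cs B ∥₄
    ≡⟨ ∑-swap (vectors forms d) Bs _ ⟩
  ∑[ B ∈ Bs ] ∑[ cs ∈ vectors forms d ] u (signCount cs) * ∥ value cs B ∥₄
    ≡⟨ ∑-cong Bs (λ B → ∑-cong (vectors forms d) λ cs →
         cong (λ n → u (signCount cs) * ∥ n ∥₄) (*-identityˡ (value cs B))) ⟨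
  ∑[ B ∈ Bs ] cost u 1 B ∎
  where open ≤-Reasoning

-- A rounded solution of the linear program that maximises the lower bound;
-- its optimum is 245/4.
weight : ℕ → ℕ
weight 0 = 90
weight 2 = 6
weight 3 = 2
weight 4 = 1
weight 5 = 1
weight _ = 0

-- Decided by running through all 64 sets `K`. The constant 5796 is the maximum, attained when
-- exactly two sides are pairs.
pairCost-bound : (K : Subset 6) → pairCost weight 1 K ≤ 5796
pairCost-bound K = ≮⇒≥ λ 5796<cost →
  from-no (anySubset? {n = 6} (λ K → 5796 <? pairCost weight 1 K)) (K , 5796<cost)

60*5796≤∑-weights : 60 * 5796 ≤ ∑[ cs ∈ vectors forms 6 ] weight (signCount cs) * 2
-- With `j` sign sums there are C(6,j)·3^6 functionals, so the right side is 2·729·241 = 351378,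
-- against 347760 on the left.
60*5796≤∑-weights = from-yes (60 * 5796 ≤? (∑[ cs ∈ vectors forms 6 ] weight (signCount cs) * 2))

theorem5p2 : (Bs : List (Box 6)) → IsDoubleCover Bs → 60 ≤ length Bs
theorem5p2 Bs cover = *-cancelʳ-≤ 60 (length Bs) 5796 (begin
  60 * 5796                                                  ≤⟨ 60*5796≤∑-weights ⟩
  ∑[ cs ∈ vectors forms 6 ] weight (signCount cs) * 2        ≤⟨ ∑-weights≤∑-cost weight Bs cover ⟩
  ∑[ B ∈ Bs ] cost weight 1 B                                ≤⟨ ∑-bounded (All.map bound (IsDoubleCover.proper cover)) ⟩
  length Bs * 5796                                           ∎)
  where
  open ≤-Reasoning
  bound : ∀ {B} → IsProper B → cost weight 1 B ≤ 5796
  bound {B} proper = ≤-trans (≤-reflexive (cost≡pairCost weight 1 proper)) (pairCost-bound (Vec.map isPair B))
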